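{- Let $\tau(n)$ be the number of unlabelled trees (isomorphism classes of trees) on $n$ vertices and $\sigma(n)$ the number of those that satisfy the neighbour sum property. Then the trees satisfying the neighbour sum property have positive density, i.e. $\liminf_{n\to\infty}\sigma(n)/\tau(n)>0$.
   Context: A graph $\mathcal G=(\mathcal V,\mathcal E)$ satisfies the neighbour sum property if there exists $f:\mathcal V\to\mathbb R$ with $f\not\equiv 0$ such that $f(x)=\sum_{y:\{x,y\}\in\mathcal E} f(y)$ for every $x\in\mathcal V$. -}

module Defs where

open import Data.Nat using (ℕ; zero; suc; _*_; _≤_)
open import Data.Fin using (Fin; zero; suc)
open import Data.Bool using (Bool; true; false; if_then_else_)
open import Data.List using (List; []; _∷_)
open import Data.List.Relation.Unary.Unique.Propositional using (Unique)
open import Data.Product using (Σ; ∃; _×_; _,_)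
open import Data.Empty using (⊥)
open import Relation.Nullary using (¬_)
open import Relation.Binary.PropositionalEquality using (_≡_; _≢_)
open import Data.Rational using (ℚ; 0ℚ; _+_)
open import Data.Fin.Permutation using (Permutation′; _⟨$⟩ʳ_)

record Graph (n : ℕ) : Set where
  field
    adj    : Fin n → Fin n → Bool
    sym    : ∀ x y → adj x y ≡ adj y x
    irrefl : ∀ x → adj x x ≡ false

open Graph public

Adj : ∀ {n} → Graph n → Fin n → Fin n → Set
Adj G x y = adj G x y ≡ true

data Walk {n : ℕ} (G : Graph n) : Fin n → Fin n → Set where
  here : ∀ {x} → Walk G x x
  step : ∀ {x y z} → Adj G x y → Walk G y z → Walk G x z

Connected : ∀ {n} → Graph n → Set
Connected G = ∀ x y → Walk G x y

ChainTo : ∀ {n} → Graph n → Fin n → List (Fin n) → Set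
ChainTo G v []           = ⊥
ChainTo G v (x ∷ [])     = Adj G x v
ChainTo G v (x ∷ y ∷ xs) = Adj G x y × ChainTo G v (y ∷ xs)

IsCycle : ∀ {n} → Graph n → List (Fin n) → Set
IsCycle G []                   = ⊥
IsCycle G (_ ∷ [])             = ⊥
IsCycle G (_ ∷ _ ∷ [])         = ⊥
IsCycle G (v ∷ w ∷ u ∷ rest)   =
  Unique (v ∷ w ∷ u ∷ rest) × ChainTo G v (v ∷ w ∷ u ∷ rest)

Acyclic : ∀ {n} → Graph n → Set
Acyclic G = ∀ vs → ¬ IsCycle G vs

IsTree : ∀ {n} → Graph n → Set
IsTree G = Connected G × Acyclic G

∑ : ∀ n → (Fin n → ℚ) → ℚ
∑ zero    f = 0ℚ
∑ (suc n) f = f zero + ∑ n (λ i → f (suc i))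

NSP : ∀ {n} → Graph n → Set
NSP {n} G = Σ (Fin n → ℚ) λ f →
  (∃ λ x → f x ≢ 0ℚ) ×
  (∀ x → f x ≡ ∑ n (λ y → if adj G x y then f y else 0ℚ))

_≅_ : ∀ {n} → Graph n → Graph n → Set
_≅_ {n} G H = Σ (Permutation′ n) λ π →
  ∀ x y → adj G x y ≡ adj H (π ⟨$⟩ʳ x) (π ⟨$⟩ʳ y)

-- R : Fin k → Graph n is a system of representatives of the isomorphism
-- classes of graphs on Fin n satisfying P: each R i satisfies P, the R i are
-- pairwise non-isomorphic, and every graph satisfying P is isomorphic to
-- some R i.  Then k is the number of isomorphism classes.
IsRepSystem : ∀ {n k} → (Graph n → Set) → (Fin k → Graph n) → Set
IsRepSystem {n} {k} P R =
  (∀ i → P (R i)) ×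
  (∀ i j → R i ≅ R j → i ≡ j) ×
  (∀ G → P G → ∃ λ i → G ≅ R i)

IsNSPTree : ∀ {n} → Graph n → Set
IsNSPTree G = IsTree G × NSP G

{-# OPTIONS --safe #-}
-- If a vertex w carries two pendant paths w - a - b and w - a′ - b′ (a gadget),
-- then f = 1 on a, b and f = -1 on a′, b′ shows the neighbour sum property.
-- Every tree on n ≥ 6 vertices splits at some vertex v into a base and a piece h
-- with 6 to 10 vertices that share only v.  In a tree without gadgets replace h
-- by a broom of the same size: v with two pendant paths and some leaves.  In the
-- result v is the only gadget vertex, and cancelling the broom at v recovers the
-- base up to isomorphism.  So the tree is determined by an NSP tree and one of
-- finitely many pieces h, which bounds τ(n) by a constant multiple of σ(n).
module Submission where

open import Defs hiding (sym)
import Defs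
open import Data.Nat using (ℕ; zero; suc; _+_; _*_; _∸_; _≤_; _<_; z≤n; s≤s; _≤?_)
open import Data.Nat.Properties using (+-mono-≤; ≰⇒>; +-assoc; +-monoʳ-≤; +-monoˡ-≤; m+[n∸m]≡n; +-cancelˡ-≡; *-identityˡ; ≤-pred; ≤-trans; ≤-reflexive; ≤-<-connex; ≤⇒≯; <⇒≤; <-trans; +-suc; +-comm; m≤m+n; n≤0⇒n≡0; 1+n≰n) renaming (suc-injective to ℕ-suc-injective)
open import Data.Fin using (Fin; zero; suc; combine; fromℕ<)
open import Data.Fin.Properties using (_≟_; any?; all?; ¬∀⟶∃¬; +↔⊎; 1↔⊤; injective⇒≤; combine-injective; suc-injective)
open import Data.Fin.Permutation using (permutation; _⟨$⟩ʳ_; _⟨$⟩ˡ_; inverseˡ; inverseʳ; ↔⇒≡)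
open import Data.Bool using (Bool; true; false; if_then_else_)
import Data.Bool.Properties as Bool
open import Data.List using (List; []; _∷_; _++_; map)
open import Data.List.Membership.Propositional using (_∈_)
open import Data.List.Membership.Propositional.Properties using (∈-map⁻)
open import Data.List.Relation.Unary.Any using (here; there)
open import Data.List.Relation.Unary.All as All using (All; []; _∷_)
open import Data.List.Relation.Unary.AllPairs using ([]; _∷_)
open import Data.List.Relation.Unary.Unique.Propositional using (Unique)
open import Data.List.Relation.Unary.Unique.Propositional.Properties using (map⁺; ++⁺)
open import Data.Sum as Sum using (_⊎_; inj₁; inj₂; [_,_]′)
open import Data.Sum.Properties using (inj₁-injective; inj₂-injective; ≡-dec)
open import Data.Sum.Function.Propositional using (_⊎-↔_)
open import Data.Product using (Σ; ∃; ∃₂; _×_; _,_; proj₁; proj₂)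
open import Data.Empty using (⊥)
open import Data.Unit using (⊤; tt)
import Data.Unit.Properties as Unit
open import Data.Rational using (ℚ; 0ℚ; 1ℚ) renaming (_+_ to _+ℚ_; _-_ to _-ℚ_)
import Data.Rational.Properties as ℚ
open import Data.Rational.Solver using (module +-*-Solver)
open import Function using (_∘_; id; _↔_; Inverse; mk↔ₛ′)
open import Function.Properties.Inverse using (↔-sym; ↔-trans)
open import Relation.Nullary using (¬_; Dec; yes; no; contradiction; does; ¬?; _×-dec_; _⊎-dec_; _→-dec_)
open import Relation.Nullary.Decidable using (dec-true; dec-false; map′)
open import Relation.Binary.Definitions using (DecidableEquality)
open import Relation.Binary.PropositionalEquality using (_≡_; _≢_; refl; sym; trans; cong; cong₂; subst; subst₂; ≢-sym; module ≡-Reasoning)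

-- The obstacle is that an isomorphism of two glued trees need not respect the gluing: it may move
-- the gluing vertex, and even with that vertex fixed it may carry parts of a base into the broom.
-- Gadgets are invariant under isomorphism, which pins the gluing vertex down; the second freedom is
-- removed by cancelling the broom one leaf or path at a time. The lower bound 6 is the size of the
-- smallest broom (root, two paths of two vertices, one leaf); further leaves adapt it to larger
-- pieces. The combinatorics takes place on rooted trees defined by recursion, whose vertex types
-- are disjoint sums. Isomorphisms then follow the construction, and `Fin n` enters only when the
-- results are carried over to graphs.

record Digraph : Set₁ where
  field
    Vertex : Set
    Edge   : Vertex → Vertex → Set

open Digraph

infix 4 _≃_

record _≃_ (A B : Digraph) : Set where
  field
    to        : Vertex A → Vertex B
    from      : Vertex B → Vertex A
    from∘to   : ∀ x → from (to x) ≡ x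
    to∘from   : ∀ y → to (from y) ≡ y
    to-edge   : ∀ x y → Edge A x y → Edge B (to x) (to y)
    from-edge : ∀ x y → Edge B x y → Edge A (from x) (from y)

open _≃_

≃-refl : ∀ {A} → A ≃ A
≃-refl = record
  { to = id ; from = id ; from∘to = λ _ → refl ; to∘from = λ _ → refl
  ; to-edge = λ _ _ → id ; from-edge = λ _ _ → id }

≃-sym : ∀ {A B} → A ≃ B → B ≃ A
≃-sym π = record
  { to = from π ; from = to π ; from∘to = to∘from π ; to∘from = from∘to π
  ; to-edge = from-edge π ; from-edge = to-edge π }

≃-trans : ∀ {A B C} → A ≃ B → B ≃ C → A ≃ C
≃-trans π ρ = record
  { to = to ρ ∘ to π ; from = from π ∘ from ρ
  ; from∘to = λ x → trans (cong (from π) (from∘to ρ (to π x))) (from∘to π x)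
  ; to∘from = λ y → trans (cong (to ρ) (to∘from π (from ρ y))) (to∘from ρ y)
  ; to-edge = λ x y → to-edge ρ _ _ ∘ to-edge π x y
  ; from-edge = λ x y → from-edge π _ _ ∘ from-edge ρ x y }

to-injective : ∀ {A B} (π : A ≃ B) {x y} → to π x ≡ to π y → x ≡ y
to-injective π {x} {y} eq = trans (sym (from∘to π x)) (trans (cong (from π) eq) (from∘to π y))

to≡⇒from≡ : ∀ {A B} (π : A ≃ B) {x y} → to π x ≡ y → from π y ≡ x
to≡⇒from≡ π {x} refl = from∘to π x

reflect-edge : ∀ {A B} (π : A ≃ B) {x y} → Edge B (to π x) (to π y) → Edge A x y
reflect-edge {A} π {x} {y} e =
  subst (λ u → Edge A u y) (from∘to π x)
    (subst (Edge A _) (from∘to π y) (from-edge π _ _ e))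

-- Joining two digraphs by an edge

LinkEdge : ∀ A B → Vertex A → Vertex B → Vertex A ⊎ Vertex B → Vertex A ⊎ Vertex B → Set
LinkEdge A B p q (inj₁ x) (inj₁ y) = Edge A x y
LinkEdge A B p q (inj₁ x) (inj₂ y) = x ≡ p × y ≡ q
LinkEdge A B p q (inj₂ x) (inj₁ y) = x ≡ q × y ≡ p
LinkEdge A B p q (inj₂ x) (inj₂ y) = Edge B x y

Link : ∀ A B → Vertex A → Vertex B → Digraph
Link A B p q = record { Vertex = Vertex A ⊎ Vertex B ; Edge = LinkEdge A B p q }

Link-map : ∀ {A A′ B B′ p p′ q q′} (f : Vertex A → Vertex A′) (g : Vertex B → Vertex B′) →
  (∀ x y → Edge A x y → Edge A′ (f x) (f y)) → (∀ x y → Edge B x y → Edge B′ (g x) (g y)) →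
  f p ≡ p′ → g q ≡ q′ → ∀ x y →
  LinkEdge A B p q x y → LinkEdge A′ B′ p′ q′ (Sum.map f g x) (Sum.map f g y)
Link-map f g fe ge fp gq (inj₁ x) (inj₁ y) e = fe x y e
Link-map f g fe ge fp gq (inj₁ x) (inj₂ y) (refl , refl) = fp , gq
Link-map f g fe ge fp gq (inj₂ x) (inj₁ y) (refl , refl) = gq , fp
Link-map f g fe ge fp gq (inj₂ x) (inj₂ y) e = ge x y e

Link-cong : ∀ {A A′ B B′ p p′ q q′} (α : A ≃ A′) (β : B ≃ B′) →
  to α p ≡ p′ → to β q ≡ q′ → Link A B p q ≃ Link A′ B′ p′ q′
Link-cong α β αp βq = record
  { to = Sum.map (to α) (to β) ; from = Sum.map (from α) (from β)
  ; from∘to = λ { (inj₁ x) → cong inj₁ (from∘to α x) ; (inj₂ y) → cong inj₂ (from∘to β y) }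
  ; to∘from = λ { (inj₁ x) → cong inj₁ (to∘from α x) ; (inj₂ y) → cong inj₂ (to∘from β y) }
  ; to-edge = Link-map _ _ (to-edge α) (to-edge β) αp βq
  ; from-edge = Link-map _ _ (from-edge α) (from-edge β) (to≡⇒from≡ α αp) (to≡⇒from≡ β βq) }

Link-comm-edge : ∀ {A B p q} x y → LinkEdge A B p q x y → LinkEdge B A q p (Sum.swap x) (Sum.swap y)
Link-comm-edge (inj₁ x) (inj₁ y) e = e
Link-comm-edge (inj₁ x) (inj₂ y) e = e
Link-comm-edge (inj₂ x) (inj₁ y) e = e
Link-comm-edge (inj₂ x) (inj₂ y) e = e

Link-comm : ∀ {A B p q} → Link A B p q ≃ Link B A q p
Link-comm = record
  { to = Sum.swap ; from = Sum.swap
  ; from∘to = λ { (inj₁ x) → refl ; (inj₂ y) → refl }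
  ; to∘from = λ { (inj₁ x) → refl ; (inj₂ y) → refl }
  ; to-edge = Link-comm-edge ; from-edge = Link-comm-edge }

⊎-exchange : ∀ {X Y Z : Set} → (X ⊎ Y) ⊎ Z → (X ⊎ Z) ⊎ Y
⊎-exchange (inj₁ (inj₁ x)) = inj₁ (inj₁ x)
⊎-exchange (inj₁ (inj₂ y)) = inj₂ y
⊎-exchange (inj₂ z) = inj₁ (inj₂ z)

⊎-exchange-involutive : ∀ {X Y Z : Set} (v : (X ⊎ Y) ⊎ Z) → ⊎-exchange (⊎-exchange v) ≡ v
⊎-exchange-involutive (inj₁ (inj₁ x)) = refl
⊎-exchange-involutive (inj₁ (inj₂ y)) = refl
⊎-exchange-involutive (inj₂ z) = refl

Link-exchange-edge : ∀ {A B C p p′ q r} x y →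
  LinkEdge (Link A B p q) C (inj₁ p′) r x y →
  LinkEdge (Link A C p′ r) B (inj₁ p) q (⊎-exchange x) (⊎-exchange y)
Link-exchange-edge (inj₁ (inj₁ x)) (inj₁ (inj₁ y)) e = e
Link-exchange-edge (inj₁ (inj₁ x)) (inj₁ (inj₂ y)) (refl , refl) = refl , refl
Link-exchange-edge (inj₁ (inj₁ x)) (inj₂ y) (refl , refl) = refl , refl
Link-exchange-edge (inj₁ (inj₂ x)) (inj₁ (inj₁ y)) (refl , refl) = refl , refl
Link-exchange-edge (inj₁ (inj₂ x)) (inj₁ (inj₂ y)) e = e
Link-exchange-edge (inj₁ (inj₂ x)) (inj₂ y) (() , _)
Link-exchange-edge (inj₂ x) (inj₁ (inj₁ y)) (refl , refl) = refl , refl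
Link-exchange-edge (inj₂ x) (inj₁ (inj₂ y)) (_ , ())
Link-exchange-edge (inj₂ x) (inj₂ y) e = e

-- `B` and `C` both hang at vertices of `A`, so their order is immaterial. This moves a subtree
-- attached deep inside a tree outwards past later children.
Link-exchange : ∀ {A B C p p′ q r} →
  Link (Link A B p q) C (inj₁ p′) r ≃ Link (Link A C p′ r) B (inj₁ p) q
Link-exchange = record
  { to = ⊎-exchange ; from = ⊎-exchange
  ; from∘to = ⊎-exchange-involutive ; to∘from = ⊎-exchange-involutive
  ; to-edge = Link-exchange-edge ; from-edge = Link-exchange-edge }

Link-assoc-edge : ∀ {A B C p q q′ r} x y →
  LinkEdge A (Link B C q′ r) p (inj₁ q) x y →
  LinkEdge (Link A B p q) C (inj₂ q′) r (Sum.assocˡ x) (Sum.assocˡ y)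
Link-assoc-edge (inj₁ x) (inj₁ y) e = e
Link-assoc-edge (inj₁ x) (inj₂ (inj₁ y)) (refl , refl) = refl , refl
Link-assoc-edge (inj₁ x) (inj₂ (inj₂ y)) (_ , ())
Link-assoc-edge (inj₂ (inj₁ x)) (inj₁ y) (refl , refl) = refl , refl
Link-assoc-edge (inj₂ (inj₁ x)) (inj₂ (inj₁ y)) e = e
Link-assoc-edge (inj₂ (inj₁ x)) (inj₂ (inj₂ y)) (refl , refl) = refl , refl
Link-assoc-edge (inj₂ (inj₂ x)) (inj₁ y) (() , _)
Link-assoc-edge (inj₂ (inj₂ x)) (inj₂ (inj₁ y)) (refl , refl) = refl , refl
Link-assoc-edge (inj₂ (inj₂ x)) (inj₂ (inj₂ y)) e = e

Link-assoc-edge⁻¹ : ∀ {A B C p q q′ r} x y →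
  LinkEdge (Link A B p q) C (inj₂ q′) r x y →
  LinkEdge A (Link B C q′ r) p (inj₁ q) (Sum.assocʳ x) (Sum.assocʳ y)
Link-assoc-edge⁻¹ (inj₁ (inj₁ x)) (inj₁ (inj₁ y)) e = e
Link-assoc-edge⁻¹ (inj₁ (inj₁ x)) (inj₁ (inj₂ y)) (refl , refl) = refl , refl
Link-assoc-edge⁻¹ (inj₁ (inj₁ x)) (inj₂ y) (() , _)
Link-assoc-edge⁻¹ (inj₁ (inj₂ x)) (inj₁ (inj₁ y)) (refl , refl) = refl , refl
Link-assoc-edge⁻¹ (inj₁ (inj₂ x)) (inj₁ (inj₂ y)) e = e
Link-assoc-edge⁻¹ (inj₁ (inj₂ x)) (inj₂ y) (refl , refl) = refl , refl
Link-assoc-edge⁻¹ (inj₂ x) (inj₁ (inj₁ y)) (_ , ())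
Link-assoc-edge⁻¹ (inj₂ x) (inj₁ (inj₂ y)) (refl , refl) = refl , refl
Link-assoc-edge⁻¹ (inj₂ x) (inj₂ y) e = e

Link-assoc : ∀ {A B C p q q′ r} →
  Link A (Link B C q′ r) p (inj₁ q) ≃ Link (Link A B p q) C (inj₂ q′) r
Link-assoc = record
  { to = Sum.assocˡ ; from = Sum.assocʳ
  ; from∘to = λ { (inj₁ x) → refl ; (inj₂ (inj₁ x)) → refl ; (inj₂ (inj₂ x)) → refl }
  ; to∘from = λ { (inj₁ (inj₁ x)) → refl ; (inj₁ (inj₂ x)) → refl ; (inj₂ x) → refl }
  ; to-edge = Link-assoc-edge ; from-edge = Link-assoc-edge⁻¹ }

-- Rooted trees, attaching and gluing

-- s ◁ t hangs t below the root of s: the child-sibling form of an ordered rooted tree.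
infixl 6 _◁_

data Rooted : Set where
  ●   : Rooted
  _◁_ : Rooted → Rooted → Rooted

⟦_⟧ : Rooted → Digraph
root : ∀ t → Vertex ⟦ t ⟧

⟦ ● ⟧ = record { Vertex = ⊤ ; Edge = λ _ _ → ⊥ }
⟦ s ◁ t ⟧ = Link ⟦ s ⟧ ⟦ t ⟧ (root s) (root t)

root ● = tt
root (s ◁ t) = inj₁ (root s)

size : Rooted → ℕ
size ● = 1
size (s ◁ t) = size s + size t

attach : ∀ t → Vertex ⟦ t ⟧ → Rooted → Rooted
attach ● _ b = ● ◁ b
attach (s ◁ t) (inj₁ x) b = attach s x b ◁ t
attach (s ◁ t) (inj₂ y) b = s ◁ attach t y b

-- The root is tracked because the induction step links at the roots of the subtrees.
attach-Link : ∀ t x b → Σ (⟦ attach t x b ⟧ ≃ Link ⟦ t ⟧ ⟦ b ⟧ x (root b)) λ π →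
  to π (root (attach t x b)) ≡ inj₁ (root t)
attach-Link ● _ b = ≃-refl , refl
attach-Link (s ◁ t) (inj₁ x) b with attach-Link s x b
... | π , eq = ≃-trans (Link-cong π ≃-refl eq refl) Link-exchange , cong (⊎-exchange ∘ inj₁) eq
attach-Link (s ◁ t) (inj₂ y) b with attach-Link t y b
... | π , eq = ≃-trans (Link-cong ≃-refl π refl eq) Link-assoc , refl

-- In child-sibling form a tree is the list of subtrees below its root, so identifying two roots is
-- concatenation of lists. The merged root accounts for the `suc` in `size-glue`.
glue : Rooted → Rooted → Rooted
glue s ● = s
glue s (h ◁ k) = glue s h ◁ k

inGlue : ∀ {s} h → Vertex ⟦ s ⟧ → Vertex ⟦ glue s h ⟧
inGlue ● x = x
inGlue (h ◁ k) x = inj₁ (inGlue h x)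

size-glue : ∀ s h → suc (size (glue s h)) ≡ size s + size h
size-glue s ● = +-comm 1 (size s)
size-glue s (h ◁ k) = trans (cong (_+ size k) (size-glue s h)) (+-assoc (size s) (size h) (size k))

-- Enlarging the base commutes with gluing. The last component follows the vertices of the enlarged
-- base, so that the mark of a decomposition can be carried along.
glue-attach-Link : ∀ s x b h →
  Σ (⟦ glue (attach s x b) h ⟧ ≃ Link ⟦ glue s h ⟧ ⟦ b ⟧ (inGlue h x) (root b)) λ π →
  to π (root (glue (attach s x b) h)) ≡ inj₁ (root (glue s h)) ×
  ∀ z → to π (inGlue h (from (proj₁ (attach-Link s x b)) z)) ≡ Sum.map₁ (inGlue h) z
glue-attach-Link s x b ● with attach-Link s x b
... | π , eq = π , eq , λ { (inj₁ z) → to∘from π _ ; (inj₂ z) → to∘from π _ }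
glue-attach-Link s x b (h ◁ k) with glue-attach-Link s x b h
... | π , eq , tracks =
  ≃-trans (Link-cong π ≃-refl eq refl) Link-exchange ,
  cong (⊎-exchange ∘ inj₁) eq ,
  λ { (inj₁ z) → cong (⊎-exchange ∘ inj₁) (tracks (inj₁ z))
    ; (inj₂ z) → cong (⊎-exchange ∘ inj₁) (tracks (inj₂ z)) }

glue-cong : ∀ {s t} (π : ⟦ s ⟧ ≃ ⟦ t ⟧) → to π (root s) ≡ root t → ∀ h →
  Σ (⟦ glue s h ⟧ ≃ ⟦ glue t h ⟧) λ ρ → to ρ (root (glue s h)) ≡ root (glue t h)
glue-cong π eq ● = π , eq
glue-cong π eq (h ◁ k) with glue-cong π eq h
... | ρ , eq′ = Link-cong ρ ≃-refl eq′ refl , cong inj₁ eq′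

glue-● : ∀ t → Σ (⟦ t ⟧ ≃ ⟦ glue ● t ⟧) λ π → to π (root t) ≡ root (glue ● t) × root (glue ● t) ≡ inGlue t tt
glue-● ● = ≃-refl , refl , refl
glue-● (s ◁ t) with glue-● s
... | π , eq , eq′ = Link-cong π ≃-refl eq refl , cong inj₁ eq , cong inj₁ eq′

-- Splitting off a piece of bounded size

record Decomposition (t : Rooted) : Set where
  field
    base piece : Rooted
    6≤piece    : 6 ≤ size piece
    piece≤10   : size piece ≤ 10
    iso        : ⟦ t ⟧ ≃ ⟦ glue base piece ⟧
    -- The position of the root of t, needed to hang t into a larger tree.
    mark       : Vertex ⟦ base ⟧
    root↦mark  : to iso (root t) ≡ inGlue piece mark

-- The root of `s` corresponds to a base vertex, so hanging `b` there enlarges the base and leaves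
-- the piece alone. The root of `t` may lie on either side, depending on which half of `t` was
-- decomposed.
decompose-Link : ∀ {s} b → Decomposition s → ∀ {t} (π : ⟦ t ⟧ ≃ Link ⟦ s ⟧ ⟦ b ⟧ (root s) (root b)) →
  to π (root t) ≡ inj₁ (root s) ⊎ to π (root t) ≡ inj₂ (root b) → Decomposition t
decompose-Link {s} b D {t} π at-root = record
  { base = attach base mark b ; piece = piece ; 6≤piece = 6≤piece ; piece≤10 = piece≤10
  ; iso = ≃-trans π (≃-trans (Link-cong iso ≃-refl root↦mark refl) (≃-sym σ))
  ; mark = from (proj₁ (attach-Link base mark b)) (proj₁ (position at-root))
  ; root↦mark = to≡⇒from≡ σ (trans (proj₂ (proj₂ linked) _) (proj₂ (position at-root))) }
  where
  open Decomposition D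
  linked = glue-attach-Link base mark b piece
  σ = proj₁ linked
  position : to π (root t) ≡ inj₁ (root s) ⊎ to π (root t) ≡ inj₂ (root b) →
    ∃ λ w → Sum.map₁ (inGlue piece) w ≡ Sum.map₁ (to iso) (to π (root t))
  position (inj₁ eq) = inj₁ mark , trans (cong inj₁ (sym root↦mark)) (cong (Sum.map₁ (to iso)) (sym eq))
  position (inj₂ eq) = inj₂ (root b) , cong (Sum.map₁ (to iso)) (sym eq)

-- Descends into a half with at least 6 vertices. If both halves have at most 5, the whole tree is
-- the piece, whence the bound 10 = 5 + 5.
decompose : ∀ t → 6 ≤ size t → Decomposition t
decompose ● (s≤s ())
decompose (s ◁ t) 6≤ with 6 ≤? size s | 6 ≤? size t
... | yes p | _ = decompose-Link t (decompose s p) ≃-refl (inj₁ refl)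
-- Here the half `s` containing the old root is what gets hung onto the decomposed half `t`.
... | no _ | yes q = decompose-Link s (decompose t q) Link-comm (inj₂ refl)
... | no ¬p | no ¬q with glue-● (s ◁ t)
... | π , eq , eq′ = record
  { base = ● ; piece = s ◁ t ; 6≤piece = 6≤
  ; piece≤10 = +-mono-≤ (≤-pred (≰⇒> ¬p)) (≤-pred (≰⇒> ¬q))
  ; iso = π ; mark = tt ; root↦mark = trans eq eq′ }

-- Cancelling pendant bricks

-- A pendant copy X is cancelled from both sides by rerouting: a vertex that π
-- sends into X is sent on by π from there.
module _ {A B X : Digraph} {p : Vertex A} {q : Vertex B} {r : Vertex X} where

  data Reroute (π : Link A X p r ≃ Link B X q r) (y : Vertex A) (z : Vertex B) : Set where
    direct : to π (inj₁ y) ≡ inj₁ z → Reroute π y z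
    detour : ∀ x → to π (inj₁ y) ≡ inj₂ x → to π (inj₂ x) ≡ inj₁ z → Reroute π y z

  -- With at most one pass through `X`, rerouting needs no termination argument.
  NoSecondDetour : Link A X p r ≃ Link B X q r → Set
  NoSecondDetour π = ∀ y x x′ → to π (inj₁ y) ≡ inj₂ x → to π (inj₂ x) ≢ inj₂ x′

  reroute : ∀ π → NoSecondDetour π → ∀ y → ∃ (Reroute π y)
  reroute π once y with to π (inj₁ y) in eq
  ... | inj₁ z = z , direct eq
  ... | inj₂ x with to π (inj₂ x) in eq′
  ... | inj₁ z = z , detour x eq eq′
  ... | inj₂ x′ = contradiction eq′ (once y x x′ eq)

  Reroute-functional : ∀ π {y z z′} → Reroute π y z → Reroute π y z′ → z ≡ z′
  Reroute-functional π (direct e) (direct e′) = inj₁-injective (trans (sym e) e′)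
  Reroute-functional π (direct e) (detour x e′ _) with () ← trans (sym e) e′
  Reroute-functional π (detour x e _) (direct e′) with () ← trans (sym e) e′
  Reroute-functional π (detour x e f) (detour x′ e′ f′) with refl ← trans (sym e) e′ =
    inj₁-injective (trans (sym f) f′)

  -- If only one end detours, the edge is mapped to the joining edge of `B` and `X`, so the detour
  -- enters `X` at `r`. As `π` takes `p` to `q`, the image of the joining edge between `p` and `r`
  -- is the edge sought. If both ends detour, `π` is applied to the edge twice.
  Reroute-edge : ∀ π → to π (inj₁ p) ≡ inj₁ q → ∀ {y y′ z z′} →
    Reroute π y z → Reroute π y′ z′ → Edge A y y′ → Edge B z z′
  Reroute-edge π πp (direct e) (direct e′) edge =
    subst₂ (LinkEdge B X q r) e e′ (to-edge π _ _ edge)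
  Reroute-edge π πp {z′ = z′} (direct e) (detour x e′ f) edge
    with refl , refl ← subst₂ (LinkEdge B X q r) e e′ (to-edge π _ _ edge) =
    subst₂ (LinkEdge B X q r) πp f (to-edge π (inj₁ p) (inj₂ x) (refl , refl))
  Reroute-edge π πp (detour x e f) (direct e′) edge
    with refl , refl ← subst₂ (LinkEdge B X q r) e e′ (to-edge π _ _ edge) =
    subst₂ (LinkEdge B X q r) f πp (to-edge π (inj₂ x) (inj₁ p) (refl , refl))
  Reroute-edge π πp (detour x e f) (detour x′ e′ f′) edge =
    subst₂ (LinkEdge B X q r) f f′
      (to-edge π (inj₂ x) (inj₂ x′) (subst₂ (LinkEdge B X q r) e e′ (to-edge π _ _ edge)))

Reroute-sym : ∀ {A B X p q r} (π : Link A X p r ≃ Link B X q r) {y z} →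
  Reroute π y z → Reroute (≃-sym π) z y
Reroute-sym π (direct e) = direct (to≡⇒from≡ π e)
Reroute-sym π (detour x e f) = detour x (to≡⇒from≡ π f) (to≡⇒from≡ π e)

Link-cancel : ∀ {A B X p q r} (π : Link A X p r ≃ Link B X q r) →
  to π (inj₁ p) ≡ inj₁ q → NoSecondDetour π → NoSecondDetour (≃-sym π) →
  Σ (A ≃ B) λ ρ → to ρ p ≡ q
Link-cancel {p = p} π πp once once⁻¹ = record
  { to = proj₁ ∘ forth ; from = proj₁ ∘ back
  ; from∘to = λ y → Reroute-functional (≃-sym π) (proj₂ (back _)) (Reroute-sym π (proj₂ (forth y)))
  ; to∘from = λ z → Reroute-functional π (proj₂ (forth _)) (Reroute-sym (≃-sym π) (proj₂ (back z)))
  ; to-edge = λ y y′ → Reroute-edge π πp (proj₂ (forth y)) (proj₂ (forth y′))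
  ; from-edge = λ z z′ → Reroute-edge (≃-sym π) (to≡⇒from≡ π πp) (proj₂ (back z)) (proj₂ (back z′))
  } , Reroute-functional π (proj₂ (forth p)) (direct πp)
  where
  forth = reroute π once
  back = reroute (≃-sym π) once⁻¹

P₂ : Rooted
P₂ = ● ◁ ●

data Brick : Rooted → Set where
  leaf : Brick ●
  path : Brick P₂

data Bricks : Rooted → Set where
  ●   : Bricks ●
  _◁_ : ∀ {h k} → Bricks h → Brick k → Bricks (h ◁ k)

-- A brick vertex mapped into the brick keeps its place, since adjacency to the vertex carrying the
-- brick tells the two vertices of a path apart. Injectivity then bars `y` from being sent to that
-- place.
Brick-noSecondDetour : ∀ {A B p q k} → Brick k →
  (π : Link A ⟦ k ⟧ p (root k) ≃ Link B ⟦ k ⟧ q (root k)) → to π (inj₁ p) ≡ inj₁ q → NoSecondDetour π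
Brick-noSecondDetour leaf π πp y x x′ e f with () ← to-injective π (trans e (sym f))
Brick-noSecondDetour path π πp y (inj₁ _) (inj₁ _) e f with () ← to-injective π (trans e (sym f))
Brick-noSecondDetour path π πp y (inj₂ _) (inj₂ _) e f with () ← to-injective π (trans e (sym f))
Brick-noSecondDetour {B = B} {p} {q} path π πp y (inj₁ tt) (inj₂ tt) e f
  with _ , () ← subst₂ (LinkEdge B ⟦ P₂ ⟧ q (inj₁ tt)) πp f (to-edge π (inj₁ p) (inj₂ (inj₁ tt)) (refl , refl))
Brick-noSecondDetour {A} {B} {p} {q} path π πp y (inj₂ tt) (inj₁ tt) e f
  with _ , () ← reflect-edge π {inj₁ p} {inj₂ (inj₂ tt)}
         (subst₂ (LinkEdge B ⟦ P₂ ⟧ q (inj₁ tt)) (sym πp) (sym f) (refl , refl))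

-- Bricks go one at a time because an isomorphism may permute equal bricks, which would produce
-- longer detours through the whole of `h`.
glue-cancel : ∀ {s t h} → Bricks h → (π : ⟦ glue s h ⟧ ≃ ⟦ glue t h ⟧) →
  to π (root (glue s h)) ≡ root (glue t h) → Σ (⟦ s ⟧ ≃ ⟦ t ⟧) λ ρ → to ρ (root s) ≡ root t
glue-cancel ● π eq = π , eq
glue-cancel (bs ◁ b) π eq
  with Link-cancel π eq (Brick-noSecondDetour b π eq) (Brick-noSecondDetour b (≃-sym π) (to≡⇒from≡ π eq))
... | ρ , eq′ = glue-cancel bs ρ eq′

-- Gadgets and how they survive gluing

PendantPath : ∀ A → (w a b : Vertex A) → Set
PendantPath A w a b =
  Edge A w a × Edge A a b × w ≢ b ×
  (∀ y → Edge A a y → y ≡ w ⊎ y ≡ b) × (∀ y → Edge A b y → y ≡ a)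

Gadget : ∀ A → Vertex A → Set
Gadget A w = ∃₂ λ a b → ∃₂ λ a′ b′ → a ≢ a′ × PendantPath A w a b × PendantPath A w a′ b′

PendantPath-≃ : ∀ {A B w a b} (π : A ≃ B) → PendantPath A w a b → PendantPath B (to π w) (to π a) (to π b)
PendantPath-≃ {A} {B} π (wa , ab , w≢b , onlyA , onlyB) =
  to-edge π _ _ wa , to-edge π _ _ ab , w≢b ∘ to-injective π ,
  (λ y e → Sum.map (back y) (back y) (onlyA (from π y) (pull e))) ,
  (λ y e → back y (onlyB (from π y) (pull e)))
  where
  back : ∀ y {x} → from π y ≡ x → y ≡ to π x
  back y eq = trans (sym (to∘from π y)) (cong (to π) eq)
  pull : ∀ {x y} → Edge B (to π x) y → Edge A x (from π y)
  pull e = subst (λ u → Edge A u _) (from∘to π _) (from-edge π _ _ e)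

Gadget-≃ : ∀ {A B w} (π : A ≃ B) → Gadget A w → Gadget B (to π w)
Gadget-≃ π (_ , _ , _ , _ , a≢a′ , P , P′) =
  _ , _ , _ , _ , a≢a′ ∘ to-injective π , PendantPath-≃ π P , PendantPath-≃ π P′

-- A path whose two vertices avoid `r` is unaffected by what is hung at `r`; the vertex `w` carrying
-- it may still be `r`.
InnerPath : ∀ A → (r w a b : Vertex A) → Set
InnerPath A r w a b = a ≢ r × b ≢ r × PendantPath A w a b

InnerGadget : ∀ A → (r w : Vertex A) → Set
InnerGadget A r w = ∃₂ λ a b → ∃₂ λ a′ b′ → a ≢ a′ × InnerPath A r w a b × InnerPath A r w a′ b′

InnerPath-Link⁺ : ∀ {A B r q w a b} → InnerPath A r w a b →
  InnerPath (Link A B r q) (inj₁ r) (inj₁ w) (inj₁ a) (inj₁ b)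
InnerPath-Link⁺ {A} {B} {r} {q} {w} {a} {b} (a≢r , b≢r , wa , ab , w≢b , onlyA , onlyB) =
  a≢r ∘ inj₁-injective , b≢r ∘ inj₁-injective , wa , ab , w≢b ∘ inj₁-injective , onlyA′ , onlyB′
  where
  onlyA′ : ∀ y → LinkEdge A B r q (inj₁ a) y → y ≡ inj₁ w ⊎ y ≡ inj₁ b
  onlyA′ (inj₁ y) e = Sum.map (cong inj₁) (cong inj₁) (onlyA y e)
  onlyA′ (inj₂ y) (a≡r , _) = contradiction a≡r a≢r
  onlyB′ : ∀ y → LinkEdge A B r q (inj₁ b) y → y ≡ inj₁ a
  onlyB′ (inj₁ y) e = cong inj₁ (onlyB y e)
  onlyB′ (inj₂ y) (b≡r , _) = contradiction b≡r b≢r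

InnerGadget-glue⁺ : ∀ {s w} h → InnerGadget ⟦ s ⟧ (root s) w →
  InnerGadget ⟦ glue s h ⟧ (root (glue s h)) (inGlue h w)
InnerGadget-glue⁺ ● G = G
InnerGadget-glue⁺ (h ◁ k) G with InnerGadget-glue⁺ h G
... | _ , _ , _ , _ , a≢a′ , P , P′ =
  _ , _ , _ , _ , a≢a′ ∘ inj₁-injective , InnerPath-Link⁺ P , InnerPath-Link⁺ P′

-- A path at `r` could be part of the linked piece. Away from `r` no edge at `w` or `a` crosses
-- over, so the path stays in `A`.
InnerPath-Link⁻ : ∀ {A B r q w a b} → w ≢ r → InnerPath (Link A B r q) (inj₁ r) (inj₁ w) a b →
  ∃₂ λ a₀ b₀ → a ≡ inj₁ a₀ × InnerPath A r w a₀ b₀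
InnerPath-Link⁻ {a = inj₂ _} w≢r (_ , _ , (w≡r , _) , _) = contradiction w≡r w≢r
InnerPath-Link⁻ {a = inj₁ a} {inj₂ _} w≢r (a≢r , _ , _ , (a≡r , _) , _) =
  contradiction (cong inj₁ a≡r) a≢r
InnerPath-Link⁻ {a = inj₁ a} {inj₁ b} w≢r (a≢r , b≢r , wa , ab , w≢b , onlyA , onlyB) =
  a , b , refl , a≢r ∘ cong inj₁ , b≢r ∘ cong inj₁ , wa , ab , w≢b ∘ cong inj₁ ,
  (λ y e → Sum.map inj₁-injective inj₁-injective (onlyA (inj₁ y) e)) ,
  (λ y e → inj₁-injective (onlyB (inj₁ y) e))

Brick-degree≤1 : ∀ {k} → Brick k → ∀ {x y z} → Edge ⟦ k ⟧ x y → Edge ⟦ k ⟧ x z → y ≡ z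
Brick-degree≤1 path {inj₁ _} {inj₂ _} {inj₂ _} _ _ = refl
Brick-degree≤1 path {inj₂ _} {inj₁ _} {inj₁ _} _ _ = refl

-- A gadget vertex inside the brick would have two distinct middle neighbours. Degrees within a
-- brick are at most 1, so one of them would be `r`, which inner paths avoid.
InnerGadget-Link⁻ : ∀ {A r k w} → Brick k → w ≢ inj₁ r → InnerGadget (Link A ⟦ k ⟧ r (root k)) (inj₁ r) w →
  ∃ λ w₀ → w₀ ≢ r × InnerGadget A r w₀
InnerGadget-Link⁻ {w = inj₁ w} brick w≢r (_ , _ , _ , _ , a≢a′ , P , P′)
  with InnerPath-Link⁻ (w≢r ∘ cong inj₁) P | InnerPath-Link⁻ (w≢r ∘ cong inj₁) P′
... | _ , _ , refl , P₀ | _ , _ , refl , P₀′ =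
  w , w≢r ∘ cong inj₁ , _ , _ , _ , _ , a≢a′ ∘ cong inj₁ , P₀ , P₀′
InnerGadget-Link⁻ {w = inj₂ w} brick _ (inj₁ a , _ , _ , _ , _ , (a≢r , _ , (_ , a≡r) , _) , _) =
  contradiction (cong inj₁ a≡r) a≢r
InnerGadget-Link⁻ {w = inj₂ w} brick _ (inj₂ a , _ , inj₁ a′ , _ , _ , _ , (a′≢r , _ , (_ , a′≡r) , _)) =
  contradiction (cong inj₁ a′≡r) a′≢r
InnerGadget-Link⁻ {w = inj₂ w} brick _ (inj₂ a , _ , inj₂ a′ , _ , a≢a′ , (_ , _ , wa , _) , (_ , _ , wa′ , _)) =
  contradiction (cong inj₂ (Brick-degree≤1 brick wa wa′)) a≢a′

InnerGadget-glue⁻ : ∀ {s h w} → Bricks h → w ≢ root (glue s h) →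
  InnerGadget ⟦ glue s h ⟧ (root (glue s h)) w → ∃ λ w₀ → InnerGadget ⟦ s ⟧ (root s) w₀
InnerGadget-glue⁻ ● w≢r G = _ , G
InnerGadget-glue⁻ (bs ◁ b) w≢r G with InnerGadget-Link⁻ b w≢r G
... | _ , w₀≢r , G₀ = InnerGadget-glue⁻ bs w₀≢r G₀

Degree≥3 : ∀ A → Vertex A → Set
Degree≥3 A x = ∃₂ λ u v → ∃ λ z → (u ≢ v × u ≢ z × v ≢ z) × Edge A x u × Edge A x v × Edge A x z

-- `a` has at most two neighbours and `b` at most one.
PendantPath-avoids : ∀ {A r w a b} → Degree≥3 A r → PendantPath A w a b → InnerPath A r w a b
PendantPath-avoids {A} {r} {w} {a} {b} (u , v , z , (u≢v , u≢z , v≢z) , ru , rv , rz) P@(_ , _ , _ , onlyA , onlyB) =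
  (λ { refl → no-three (onlyA u ru) (onlyA v rv) (onlyA z rz) }) ,
  (λ { refl → u≢v (trans (onlyB u ru) (sym (onlyB v rv))) }) , P
  where
  no-three : u ≡ w ⊎ u ≡ b → v ≡ w ⊎ v ≡ b → z ≡ w ⊎ z ≡ b → ⊥
  no-three (inj₁ p) (inj₁ q) _ = u≢v (trans p (sym q))
  no-three (inj₂ p) (inj₂ q) _ = u≢v (trans p (sym q))
  no-three (inj₁ p) _ (inj₁ q) = u≢z (trans p (sym q))
  no-three (inj₂ p) _ (inj₂ q) = u≢z (trans p (sym q))
  no-three _ (inj₁ p) (inj₁ q) = v≢z (trans p (sym q))
  no-three _ (inj₂ p) (inj₂ q) = v≢z (trans p (sym q))

-- Brooms and their removal

star : ℕ → Rooted
star zero = ●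
star (suc j) = star j ◁ ●

size-star : ∀ j → size (star j) ≡ suc j
size-star zero = refl
size-star (suc j) = trans (+-comm (size (star j)) 1) (cong suc (size-star j))

star-bricks : ∀ j → Bricks (star j)
star-bricks zero = ●
star-bricks (suc j) = star-bricks j ◁ leaf

-- The last leaf raises the degree of the root to at least 3, so that the root
-- lies on no pendant path of a gadget.
broom : ℕ → Rooted
broom j = star j ◁ P₂ ◁ P₂ ◁ ●

size-broom : ∀ j → size (broom j) ≡ 6 + j
size-broom j rewrite size-star j | +-comm j 2 | +-comm j 2 | +-comm j 1 = refl

broom-bricks : ∀ j → Bricks (broom j)
broom-bricks j = star-bricks j ◁ path ◁ path ◁ leaf

broom-degree : ∀ s j → Degree≥3 ⟦ glue s (broom j) ⟧ (root (glue s (broom j)))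
broom-degree s j =
  inj₂ tt , inj₁ (inj₂ (inj₁ tt)) , inj₁ (inj₁ (inj₂ (inj₁ tt))) ,
  ((λ ()) , (λ ()) , (λ ())) , (refl , refl) , (refl , refl) , (refl , refl)

broom-gadget : ∀ s j → Gadget ⟦ glue s (broom j) ⟧ (root (glue s (broom j)))
broom-gadget s j =
  inj₁ (inj₂ (inj₁ tt)) , inj₁ (inj₂ (inj₂ tt)) , inj₁ (inj₁ (inj₂ (inj₁ tt))) , inj₁ (inj₁ (inj₂ (inj₂ tt))) ,
  (λ ()) ,
  ((refl , refl) , (refl , refl) , (λ ()) ,
    (λ { (inj₁ (inj₁ x)) (_ , refl) → inj₁ refl ; (inj₁ (inj₂ (inj₂ tt))) _ → inj₂ refl ; (inj₁ (inj₂ (inj₁ tt))) () ; (inj₂ _) (() , _) }) ,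
    (λ { (inj₁ (inj₁ x)) (() , _) ; (inj₁ (inj₂ (inj₁ tt))) _ → refl ; (inj₁ (inj₂ (inj₂ tt))) () ; (inj₂ _) (() , _) })) ,
  ((refl , refl) , (refl , refl) , (λ ()) ,
    (λ { (inj₁ (inj₁ (inj₁ x))) (_ , refl) → inj₁ refl ; (inj₁ (inj₁ (inj₂ (inj₂ tt)))) _ → inj₂ refl
       ; (inj₁ (inj₁ (inj₂ (inj₁ tt)))) () ; (inj₁ (inj₂ _)) (() , _) ; (inj₂ _) (() , _) }) ,
    (λ { (inj₁ (inj₁ (inj₁ x))) (() , _) ; (inj₁ (inj₁ (inj₂ (inj₁ tt)))) _ → refl
       ; (inj₁ (inj₁ (inj₂ (inj₂ tt)))) () ; (inj₁ (inj₂ _)) (() , _) ; (inj₂ _) (() , _) }))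

_≟ᵥ_ : ∀ {t} → DecidableEquality (Vertex ⟦ t ⟧)
_≟ᵥ_ {●} = Unit._≟_
_≟ᵥ_ {s ◁ t} = ≡-dec (_≟ᵥ_ {s}) (_≟ᵥ_ {t})

-- The degree of the root keeps it off all pendant paths, so a gadget at another vertex comes from
-- one in `s` with inner paths. That gadget would persist in `glue s h`, which has none.
gadget-unique : ∀ s h {k} → Bricks k → Degree≥3 ⟦ glue s k ⟧ (root (glue s k)) →
  (∀ w → ¬ Gadget ⟦ glue s h ⟧ w) → ∀ w → Gadget ⟦ glue s k ⟧ w → w ≡ root (glue s k)
gadget-unique s h {k} bricks deg bare w (a , b , a′ , b′ , a≢a′ , P , P′)
  with _≟ᵥ_ {glue s k} w (root (glue s k))
... | yes eq = eq
... | no w≢r with InnerGadget-glue⁻ {s} {k} {w} bricks w≢r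
                    (a , b , a′ , b′ , a≢a′ , PendantPath-avoids deg P , PendantPath-avoids deg P′)
... | w₀ , G with InnerGadget-glue⁺ {s} {w₀} h G
... | c , d , c′ , d′ , c≢c′ , (_ , _ , Q) , (_ , _ , Q′) =
  contradiction (c , d , c′ , d′ , c≢c′ , Q , Q′) (bare (inGlue h w₀))

-- `π` sends the root of `glue s k` to a gadget vertex of `glue t k`, hence to its root. This is
-- what cancellation requires; afterwards `h` is glued back.
unglue : ∀ {s t} h {k} → Bricks k → Degree≥3 ⟦ glue t k ⟧ (root (glue t k)) →
  Gadget ⟦ glue s k ⟧ (root (glue s k)) → (∀ w → ¬ Gadget ⟦ glue t h ⟧ w) →
  ⟦ glue s k ⟧ ≃ ⟦ glue t k ⟧ → ⟦ glue s h ⟧ ≃ ⟦ glue t h ⟧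
unglue {s} {t} h {k} bricks deg G bare π =
  let ρ , eq = glue-cancel {s} {t} {k} bricks π
                 (gadget-unique t h bricks deg bare _ (Gadget-≃ π G))
  in proj₁ (glue-cong {s} {t} ρ eq h)

unbroom : ∀ {s t} j h → (∀ w → ¬ Gadget ⟦ glue t h ⟧ w) →
  ⟦ glue s (broom j) ⟧ ≃ ⟦ glue t (broom j) ⟧ → ⟦ glue s h ⟧ ≃ ⟦ glue t h ⟧
unbroom {s} {t} j h = unglue {s} {t} h (broom-bricks j) (broom-degree t j) (broom-gadget s j)

-- Graphs on Fin n

⇔⇒≡ : ∀ {a b : Bool} → (a ≡ true → b ≡ true) → (b ≡ true → a ≡ true) → a ≡ b
⇔⇒≡ {true} f g = sym (f refl)
⇔⇒≡ {false} {true} f g = g refl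
⇔⇒≡ {false} {false} f g = refl

module _ {n : ℕ} where

  toDigraph : Graph n → Digraph
  toDigraph G = record { Vertex = Fin n ; Edge = Adj G }

  Adj-sym : ∀ (G : Graph n) {x y} → Adj G x y → Adj G y x
  Adj-sym G {x} {y} e = trans (Defs.sym G y x) e

  ¬Adj-refl : ∀ (G : Graph n) {x} → ¬ Adj G x x
  ¬Adj-refl G {x} e with () ← trans (sym (irrefl G x)) e

  ≃⇒≅ : ∀ {G H : Graph n} → toDigraph G ≃ toDigraph H → G ≅ H
  ≃⇒≅ π = permutation (to π) (from π) (to∘from π) (from∘to π) ,
    λ x y → ⇔⇒≡ (to-edge π x y) (reflect-edge π)

  ≅⇒≃ : ∀ {G H : Graph n} → G ≅ H → toDigraph G ≃ toDigraph H
  ≅⇒≃ {G} {H} (π , pres) = record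
    { to = π ⟨$⟩ʳ_ ; from = π ⟨$⟩ˡ_
    ; from∘to = λ _ → inverseˡ π ; to∘from = λ _ → inverseʳ π
    ; to-edge = λ x y e → trans (sym (pres x y)) e
    ; from-edge = λ x y e → trans (pres _ _)
        (subst₂ (Adj H) (sym (inverseʳ π)) (sym (inverseʳ π)) e) }

-- Gadgets and the neighbour sum property

δ : ∀ {n} → Fin n → Fin n → ℚ
δ zero zero = 1ℚ
δ zero (suc _) = 0ℚ
δ (suc _) zero = 0ℚ
δ (suc a) (suc x) = δ a x

δ-refl : ∀ {n} (a : Fin n) → δ a a ≡ 1ℚ
δ-refl zero = refl
δ-refl (suc a) = δ-refl a

δ-≢ : ∀ {n} {a x : Fin n} → a ≢ x → δ a x ≡ 0ℚ
δ-≢ {a = zero} {zero} a≢x = contradiction refl a≢x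
δ-≢ {a = zero} {suc x} a≢x = refl
δ-≢ {a = suc a} {zero} a≢x = refl
δ-≢ {a = suc a} {suc x} a≢x = δ-≢ (a≢x ∘ cong suc)

indicator : Bool → ℚ
indicator c = if c then 1ℚ else 0ℚ

∑-cong : ∀ n {f g : Fin n → ℚ} → (∀ i → f i ≡ g i) → ∑ n f ≡ ∑ n g
∑-cong zero eq = refl
∑-cong (suc n) eq = cong₂ _+ℚ_ (eq zero) (∑-cong n (eq ∘ suc))

∑-if-zero : ∀ n (c : Fin n → Bool) → ∑ n (λ y → if c y then 0ℚ else 0ℚ) ≡ 0ℚ
∑-if-zero zero c = refl
∑-if-zero (suc n) c with c zero
... | true = trans (ℚ.+-identityˡ _) (∑-if-zero n (c ∘ suc))
... | false = trans (ℚ.+-identityˡ _) (∑-if-zero n (c ∘ suc))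

∑-δ : ∀ n (c : Fin n → Bool) a → ∑ n (λ y → if c y then δ a y else 0ℚ) ≡ indicator (c a)
∑-δ (suc n) c zero = trans (cong (indicator (c zero) +ℚ_) (∑-if-zero n (c ∘ suc))) (ℚ.+-identityʳ _)
∑-δ (suc n) c (suc a) with c zero
... | true = trans (ℚ.+-identityˡ _) (∑-δ n (c ∘ suc) a)
... | false = trans (ℚ.+-identityˡ _) (∑-δ n (c ∘ suc) a)

-- The sign pattern of the solution on the two paths, isolated so that sums can be moved through it.
twist : ℚ → ℚ → ℚ → ℚ → ℚ
twist p q r s = (p +ℚ q) -ℚ (r +ℚ s)

∑-twist : ∀ n (p q r s : Fin n → ℚ) →
  ∑ n (λ y → twist (p y) (q y) (r y) (s y)) ≡ twist (∑ n p) (∑ n q) (∑ n r) (∑ n s)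
∑-twist zero p q r s = refl
∑-twist (suc n) p q r s rewrite ∑-twist n (p ∘ suc) (q ∘ suc) (r ∘ suc) (s ∘ suc) =
  solve 8 (λ p q r s P Q R S → ((p :+ q) :- (r :+ s)) :+ ((P :+ Q) :- (R :+ S)) :=
                               ((p :+ P) :+ (q :+ Q)) :- ((r :+ R) :+ (s :+ S))) refl
    (p zero) (q zero) (r zero) (s zero) _ _ _ _
  where open +-*-Solver

if-twist : ∀ c p q r s → (if c then twist p q r s else 0ℚ) ≡
  twist (if c then p else 0ℚ) (if c then q else 0ℚ) (if c then r else 0ℚ) (if c then s else 0ℚ)
if-twist true p q r s = refl
if-twist false p q r s = refl

-- At the gadget vertex the two middle vertices contribute with opposite signs; the term `w` records
-- both contributions.
twist-cancel : ∀ w a b a′ b′ → twist a b a′ b′ ≡ twist (w +ℚ b) a (w +ℚ b′) a′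
twist-cancel = solve 5 (λ w a b a′ b′ → (a :+ b) :- (a′ :+ b′) :=
                          ((w :+ b) :+ a) :- ((w :+ b′) :+ a′)) refl
  where open +-*-Solver

module _ {n : ℕ} (G : Graph n) where

  PendantPath-adj-middle : ∀ {w a b} → PendantPath (toDigraph G) w a b →
    ∀ x → indicator (adj G x a) ≡ δ w x +ℚ δ b x
  PendantPath-adj-middle {w} {a} {b} (wa , ab , w≢b , onlyA , onlyB) x with adj G x a in eq
  ... | false = sym (cong₂ _+ℚ_ (δ-≢ (not-adjacent wa)) (δ-≢ (not-adjacent (Adj-sym G ab))))
    where
    not-adjacent : ∀ {v} → Adj G v a → v ≢ x
    not-adjacent e refl with () ← trans (sym e) eq
  ... | true with onlyA x (Adj-sym G eq)
  ...   | inj₁ refl rewrite δ-refl w | δ-≢ (≢-sym w≢b) = refl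
  ...   | inj₂ refl rewrite δ-refl b | δ-≢ w≢b = refl

  PendantPath-adj-end : ∀ {w a b} → PendantPath (toDigraph G) w a b →
    ∀ x → indicator (adj G x b) ≡ δ a x
  PendantPath-adj-end {w} {a} {b} (wa , ab , w≢b , onlyA , onlyB) x with adj G x b in eq
  ... | false = sym (δ-≢ {a = a} {x} λ { refl → contradiction (trans (sym ab) eq) λ () })
  ... | true with refl ← onlyB x (Adj-sym G eq) = sym (δ-refl a)

  Gadget⇒NSP : ∀ {w} → Gadget (toDigraph G) w → NSP G
  Gadget⇒NSP {w} (a , b , a′ , b′ , a≢a′ , P@(wa , ab , w≢b , onlyA , onlyB) , P′@(wa′ , ab′ , w≢b′ , onlyA′ , onlyB′)) =
    f , (a , f-a≢0) , neighbour-sum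
    where
    f : Fin n → ℚ
    f x = twist (δ a x) (δ b x) (δ a′ x) (δ b′ x)
    a≢b : a ≢ b
    a≢b refl = ¬Adj-refl G ab
    a≢b′ : a ≢ b′
    -- If `a` were the end of the other path, its neighbours `w` and `b` would both be `a′`.
    a≢b′ refl = w≢b (trans (onlyB′ w (Adj-sym G wa)) (sym (onlyB′ b ab)))
    f-a≢0 : f a ≢ 0ℚ
    f-a≢0 rewrite δ-refl a | δ-≢ (≢-sym a≢b) | δ-≢ (≢-sym a≢a′) | δ-≢ (≢-sym a≢b′) = λ ()
    neighbour-sum : ∀ x → f x ≡ ∑ n (λ y → if adj G x y then f y else 0ℚ)
    -- By linearity the neighbour sum is the signed combination of the adjacency columns of the four
    -- path vertices.
    neighbour-sum x = begin
      twist (δ a x) (δ b x) (δ a′ x) (δ b′ x)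
        ≡⟨ twist-cancel (δ w x) _ _ _ _ ⟩
      twist (δ w x +ℚ δ b x) (δ a x) (δ w x +ℚ δ b′ x) (δ a′ x)
        ≡⟨ cong₂ _-ℚ_ (side P) (side P′) ⟨
      twist (indicator (adj G x a)) (indicator (adj G x b)) (indicator (adj G x a′)) (indicator (adj G x b′))
        ≡⟨ cong₂ _-ℚ_ (cong₂ _+ℚ_ (∑-δ n (adj G x) a) (∑-δ n (adj G x) b))
                      (cong₂ _+ℚ_ (∑-δ n (adj G x) a′) (∑-δ n (adj G x) b′)) ⟨
      twist (∑ n (λ y → if adj G x y then δ a y else 0ℚ)) (∑ n (λ y → if adj G x y then δ b y else 0ℚ))
            (∑ n (λ y → if adj G x y then δ a′ y else 0ℚ)) (∑ n (λ y → if adj G x y then δ b′ y else 0ℚ))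
        ≡⟨ ∑-twist n _ _ _ _ ⟨
      ∑ n (λ y → twist (if adj G x y then δ a y else 0ℚ) (if adj G x y then δ b y else 0ℚ)
                       (if adj G x y then δ a′ y else 0ℚ) (if adj G x y then δ b′ y else 0ℚ))
        ≡⟨ ∑-cong n (λ y → if-twist (adj G x y) _ _ _ _) ⟨
      ∑ n (λ y → if adj G x y then f y else 0ℚ) ∎
      where
      open ≡-Reasoning
      side : ∀ {c d} → PendantPath (toDigraph G) w c d →
        indicator (adj G x c) +ℚ indicator (adj G x d) ≡ (δ w x +ℚ δ d x) +ℚ δ c x
      side Q = cong₂ _+ℚ_ (PendantPath-adj-middle Q x) (PendantPath-adj-end Q x)

  gadget? : Dec (∃ (Gadget (toDigraph G)))
  gadget? = any? λ w → any? λ a → any? λ b → any? λ a′ → any? λ b′ →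
    ¬? (a ≟ a′) ×-dec pendant? w a b ×-dec pendant? w a′ b′
    where
    pendant? : ∀ w a b → Dec (PendantPath (toDigraph G) w a b)
    pendant? w a b =
      (adj G w a Bool.≟ true) ×-dec (adj G a b Bool.≟ true) ×-dec ¬? (w ≟ b) ×-dec
      all? (λ y → (adj G a y Bool.≟ true) →-dec ((y ≟ w) ⊎-dec (y ≟ b))) ×-dec
      all? (λ y → (adj G b y Bool.≟ true) →-dec (y ≟ a))

-- Finite trees are rooted trees

edge-sym : ∀ t x y → Edge ⟦ t ⟧ x y → Edge ⟦ t ⟧ y x
edge-sym (s ◁ t) (inj₁ x) (inj₁ y) e = edge-sym s x y e
edge-sym (s ◁ t) (inj₁ x) (inj₂ y) (p , q) = q , p
edge-sym (s ◁ t) (inj₂ x) (inj₁ y) (p , q) = q , p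
edge-sym (s ◁ t) (inj₂ x) (inj₂ y) e = edge-sym t x y e

edge-irrefl : ∀ t x → ¬ Edge ⟦ t ⟧ x x
edge-irrefl (s ◁ t) (inj₁ x) e = edge-irrefl s x e
edge-irrefl (s ◁ t) (inj₂ y) e = edge-irrefl t y e

edge? : ∀ t x y → Dec (Edge ⟦ t ⟧ x y)
edge? ● _ _ = no λ ()
edge? (s ◁ t) (inj₁ x) (inj₁ y) = edge? s x y
edge? (s ◁ t) (inj₁ x) (inj₂ y) = _≟ᵥ_ {s} x (root s) ×-dec _≟ᵥ_ {t} y (root t)
edge? (s ◁ t) (inj₂ x) (inj₁ y) = _≟ᵥ_ {t} x (root t) ×-dec _≟ᵥ_ {s} y (root s)
edge? (s ◁ t) (inj₂ x) (inj₂ y) = edge? t x y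

anyVertex? : ∀ t {P : Vertex ⟦ t ⟧ → Set} → (∀ x → Dec (P x)) → Dec (∃ P)
anyVertex? ● P? = map′ (tt ,_) proj₂ (P? tt)
anyVertex? (s ◁ t) P? = map′
  (λ { (inj₁ (x , p)) → inj₁ x , p ; (inj₂ (x , p)) → inj₂ x , p })
  (λ { (inj₁ x , p) → inj₁ (x , p) ; (inj₂ x , p) → inj₂ (x , p) })
  (anyVertex? s (P? ∘ inj₁) ⊎-dec anyVertex? t (P? ∘ inj₂))

depth : ∀ t → Vertex ⟦ t ⟧ → ℕ
depth ● _ = 0
depth (s ◁ t) (inj₁ x) = depth s x
depth (s ◁ t) (inj₂ y) = suc (depth t y)

depth-root : ∀ t → depth t (root t) ≡ 0
depth-root ● = refl
depth-root (s ◁ t) = depth-root s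

depth≡0⇒root : ∀ t x → depth t x ≡ 0 → x ≡ root t
depth≡0⇒root ● _ _ = refl
depth≡0⇒root (s ◁ t) (inj₁ x) eq = cong inj₁ (depth≡0⇒root s x eq)

no-lower-than-root : ∀ t x → Edge ⟦ t ⟧ (root t) x → ¬ depth t x ≤ depth t (root t)
no-lower-than-root t x e x≤ with refl ← depth≡0⇒root t x
  (n≤0⇒n≡0 (≤-trans x≤ (≤-reflexive (depth-root t)))) = edge-irrefl t _ e

-- A neighbour of no greater depth can only be the parent. The weak inequalities match the case
-- split used in walking round a cycle.
parent-unique : ∀ t x y z → Edge ⟦ t ⟧ x y → Edge ⟦ t ⟧ x z →
  depth t y ≤ depth t x → depth t z ≤ depth t x → y ≡ z
parent-unique (s ◁ t) (inj₁ x) (inj₁ y) (inj₁ z) e f y≤ z≤ = cong inj₁ (parent-unique s x y z e f y≤ z≤)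
parent-unique (s ◁ t) (inj₁ x) (inj₂ y) _ (refl , _) f y≤ z≤
  with () ← subst (_ ≤_) (depth-root s) y≤
parent-unique (s ◁ t) (inj₁ x) (inj₁ y) (inj₂ z) e (refl , _) y≤ z≤
  with () ← subst (_ ≤_) (depth-root s) z≤
parent-unique (s ◁ t) (inj₂ x) (inj₁ y) (inj₁ z) (_ , refl) (_ , refl) y≤ z≤ = refl
parent-unique (s ◁ t) (inj₂ x) (inj₁ y) (inj₂ z) (refl , _) f y≤ z≤ =
  contradiction (≤-pred z≤) (no-lower-than-root t z f)
parent-unique (s ◁ t) (inj₂ x) (inj₂ y) (inj₁ z) e (refl , _) y≤ z≤ =
  contradiction (≤-pred y≤) (no-lower-than-root t y e)
parent-unique (s ◁ t) (inj₂ x) (inj₂ y) (inj₂ z) e f y≤ z≤ =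
  cong inj₂ (parent-unique t x y z e f (≤-pred y≤) (≤-pred z≤))

data Path (A : Digraph) : Vertex A → Vertex A → List (Vertex A) → Set where
  [_] : ∀ x → Path A x x (x ∷ [])
  _∷_ : ∀ {x y z l} → Edge A x y → Path A y z l → Path A x z (x ∷ l)

Path-map : ∀ {A B x y l} (f : Vertex A → Vertex B) → (∀ u v → Edge A u v → Edge B (f u) (f v)) →
  Path A x y l → Path B (f x) (f y) (map f l)
Path-map f fe [ x ] = [ f x ]
Path-map f fe (e ∷ p) = fe _ _ e ∷ Path-map f fe p

Path-++ : ∀ {A x p q y l m} → Path A x p l → Edge A p q → Path A q y m → Path A x y (l ++ m)
Path-++ [ _ ] e q = e ∷ q
Path-++ (f ∷ p) e q = f ∷ Path-++ p e q

map-inj-disjoint : ∀ {A B : Set} {xs : List A} {ys : List B} {v : A ⊎ B} → ¬ (v ∈ map inj₁ xs × v ∈ map inj₂ ys)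
map-inj-disjoint (p , q) with ∈-map⁻ inj₁ p | ∈-map⁻ inj₂ q
... | _ , _ , refl | _ , _ , ()

simplePath : ∀ t x y → ∃ λ l → Path ⟦ t ⟧ x y l × Unique l
simplePath ● _ _ = _ , [ tt ] , [] ∷ []
simplePath (s ◁ t) (inj₁ x) (inj₁ y) with simplePath s x y
... | _ , p , u = _ , Path-map inj₁ (λ _ _ → id) p , map⁺ inj₁-injective u
simplePath (s ◁ t) (inj₂ x) (inj₂ y) with simplePath t x y
... | _ , p , u = _ , Path-map inj₂ (λ _ _ → id) p , map⁺ inj₂-injective u
simplePath (s ◁ t) (inj₁ x) (inj₂ y) with simplePath s x (root s) | simplePath t (root t) y
... | _ , p , u | _ , q , v =
  _ , Path-++ (Path-map inj₁ (λ _ _ → id) p) (refl , refl) (Path-map inj₂ (λ _ _ → id) q) ,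
  ++⁺ (map⁺ inj₁-injective u) (map⁺ inj₂-injective v) map-inj-disjoint
simplePath (s ◁ t) (inj₂ x) (inj₁ y) with simplePath t x (root t) | simplePath s (root s) y
... | _ , p , u | _ , q , v =
  _ , Path-++ (Path-map inj₂ (λ _ _ → id) p) (refl , refl) (Path-map inj₁ (λ _ _ → id) q) ,
  ++⁺ (map⁺ inj₂-injective u) (map⁺ inj₁-injective v) λ (a , b) → map-inj-disjoint (b , a)

Vertex↔Fin : ∀ t → Vertex ⟦ t ⟧ ↔ Fin (size t)
Vertex↔Fin ● = ↔-sym 1↔⊤
Vertex↔Fin (s ◁ t) = ↔-trans (Vertex↔Fin s ⊎-↔ Vertex↔Fin t) (↔-sym +↔⊎)

module _ {n : ℕ} (G : Graph n) where

  Path⇒Walk : ∀ {x y l} → Path (toDigraph G) x y l → Walk G x y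
  Path⇒Walk [ _ ] = here
  Path⇒Walk (e ∷ p) = step e (Path⇒Walk p)

  Path⇒ChainTo : ∀ {x y v l} → Path (toDigraph G) x y l → Adj G y v → ChainTo G v l
  Path⇒ChainTo [ _ ] f = f
  Path⇒ChainTo (e ∷ [ _ ]) f = e , f
  Path⇒ChainTo (e ∷ p@(_ ∷ _)) f = e , Path⇒ChainTo p f

  module _ (rank : Fin n → ℕ)
    (lower-unique : ∀ x y z → Adj G x y → Adj G x z → rank y ≤ rank x → rank z ≤ rank x → y ≡ z) where

    -- The next vertex on the cycle; the default `v` closes it up.
    first : Fin n → List (Fin n) → Fin n
    first v [] = v
    first v (z ∷ _) = z

    ≢-first : ∀ {v y z} zs → v ≢ y → Unique (y ∷ z ∷ zs) → y ≢ first v zs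
    ≢-first [] v≢y _ = ≢-sym v≢y
    ≢-first (_ ∷ _) _ ((_ ∷ y≢z′ ∷ _) ∷ _) = y≢z′

    -- `x` is already the one neighbour of `y` that is not above it.
    climb-step : ∀ {x y z} → Adj G x y → rank x < rank y → Adj G y z → x ≢ z → rank y < rank z
    climb-step {x} {y} {z} e x<y f x≢z with ≤-<-connex (rank z) (rank y)
    ... | inj₂ y<z = y<z
    ... | inj₁ z≤y = contradiction (lower-unique y x z (Adj-sym G e) f (<⇒≤ x<y) z≤y) x≢z

    LowLast : Fin n → List (Fin n) → Set
    LowLast v l = ∃ λ z → z ∈ l × Adj G z v × rank z ≤ rank v

    -- The inequality refutes a cycle that rises from its first vertex; `LowLast` serves a cycle
    -- that falls before it rises.
    climb : ∀ v x y rest → Adj G x y → rank x < rank y → ChainTo G v (y ∷ rest) →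
      x ≢ first v rest → All (v ≢_) (y ∷ rest) → Unique (y ∷ rest) →
      rank y < rank v × LowLast v (y ∷ rest)
    climb v x y [] e x<y yv x≢v _ _ = y<v , y , here refl , yv , <⇒≤ y<v
      where y<v = climb-step e x<y yv x≢v
    climb v x y (z ∷ zs) e x<y (yz , chain) x≢z (v≢y ∷ v≢) u@(_ ∷ u′)
      with climb-step e x<y yz x≢z
    ... | y<z with climb v y z zs yz y<z chain (≢-first zs v≢y u) v≢ u′
    ... | z<v , l , l∈ , lv , l≤ = <-trans y<z z<v , l , there l∈ , lv , l≤

    descend : ∀ v y z zs → rank y ≤ rank v → Adj G y z → ChainTo G v (z ∷ zs) →
      All (v ≢_) (y ∷ z ∷ zs) → Unique (y ∷ z ∷ zs) → LowLast v (z ∷ zs)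
    descend v y z zs y≤v yz chain (v≢y ∷ v≢) u@(_ ∷ u′) with ≤-<-connex (rank z) (rank y)
    descend v y z zs y≤v yz chain (v≢y ∷ v≢) u@(_ ∷ u′) | inj₂ y<z =
      proj₂ (climb v y z zs yz y<z chain (≢-first zs v≢y u) v≢ u′)
    descend v y z [] y≤v yz chain _ _ | inj₁ z≤y = z , here refl , chain , ≤-trans z≤y y≤v
    descend v y z (z′ ∷ zs) y≤v yz (e , chain) (_ ∷ v≢) (_ ∷ u) | inj₁ z≤y
      with descend v z z′ zs (≤-trans z≤y y≤v) e chain v≢ u
    ... | l , l∈ , lv , l≤ = l , there l∈ , lv , l≤

    -- Along a cycle ranks that start to increase keep increasing, so the last vertex
    -- is never above the first; then both neighbours of the first are below it.
    ranked⇒acyclic : Acyclic G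
    ranked⇒acyclic (v ∷ w ∷ u ∷ rest) ((v≢@(v≢w ∷ v≢u ∷ _) ∷ uniq@(w≢ ∷ _)) , vw , wu , chain)
      with ≤-<-connex (rank w) (rank v)
    ... | inj₂ v<w = contradiction v<w (≤⇒≯ (<⇒≤ (proj₁
      (climb v v w (u ∷ rest) vw v<w (wu , chain) v≢u v≢ uniq))))
    ... | inj₁ w≤v with descend v w u rest w≤v wu chain v≢ uniq
    ... | l , l∈ , lv , l≤v =
      All.lookup w≢ l∈ (lower-unique v w l vw (Adj-sym G lv) w≤v l≤v)

  ≃⇒IsTree : ∀ {t} → toDigraph G ≃ ⟦ t ⟧ → IsTree G
  ≃⇒IsTree {t} π =
    (λ x y → subst₂ (Walk G) (from∘to π x) (from∘to π y)
      (Path⇒Walk (Path-map (from π) (from-edge π) (proj₁ (proj₂ (simplePath t (to π x) (to π y))))))) ,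
    ranked⇒acyclic (depth t ∘ to π) λ x y z xy xz y≤ z≤ →
      to-injective π (parent-unique t _ _ _ (to-edge π _ _ xy) (to-edge π _ _ xz) y≤ z≤)

  record Embedding (t : Rooted) : Set where
    field
      embed     : Vertex ⟦ t ⟧ → Fin n
      injective : ∀ x y → embed x ≡ embed y → x ≡ y
      edge      : ∀ x y → Edge ⟦ t ⟧ x y → Adj G (embed x) (embed y)

    size≤ : size t ≤ n
    size≤ = injective⇒≤ {f = embed ∘ Inverse.from (Vertex↔Fin t)} λ {i} {j} eq →
      trans (sym (Inverse.strictlyInverseˡ (Vertex↔Fin t) i))
        (trans (cong (Inverse.to (Vertex↔Fin t)) (injective _ _ eq))
               (Inverse.strictlyInverseˡ (Vertex↔Fin t) j))

    Image : Fin n → Set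
    Image y = ∃ λ x → embed x ≡ y

    image? : ∀ y → Dec (Image y)
    image? y = anyVertex? t (λ x → embed x ≟ y)

    exit : ∀ x {u y} → embed x ≡ u → Walk G u y → ¬ Image y → ∃₂ λ x z → Adj G (embed x) z × ¬ Image z
    exit x eq here y∉ = contradiction (x , eq) y∉
    exit x refl (step {y = z} e walk) y∉ with image? z
    ... | no z∉ = x , z , e , z∉
    ... | yes (x′ , eq) = exit x′ eq walk y∉

  open Embedding

  extend : ∀ {t} (ε : Embedding t) x z → Adj G (embed ε x) z → ¬ Image ε z → Embedding (attach t x ●)
  extend {t} ε x z xz z∉ = record
    { embed = e′ ∘ to π
    ; injective = λ u v eq → to-injective π (inj (to π u) (to π v) eq)
    ; edge = λ u v e → hom (to π u) (to π v) (to-edge π u v e) }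
    where
    π = proj₁ (attach-Link t x ●)
    e′ : Vertex ⟦ t ⟧ ⊎ ⊤ → Fin n
    e′ = [ embed ε , (λ _ → z) ]′
    inj : ∀ u v → e′ u ≡ e′ v → u ≡ v
    inj (inj₁ u) (inj₁ v) eq = cong inj₁ (injective ε u v eq)
    inj (inj₁ u) (inj₂ _) eq = contradiction (u , eq) z∉
    inj (inj₂ _) (inj₁ v) eq = contradiction (v , sym eq) z∉
    inj (inj₂ _) (inj₂ _) eq = refl
    hom : ∀ u v → LinkEdge ⟦ t ⟧ ⟦ ● ⟧ x tt u v → Adj G (e′ u) (e′ v)
    hom (inj₁ u) (inj₁ v) e = edge ε u v e
    hom (inj₁ u) (inj₂ _) (refl , _) = xz
    hom (inj₂ _) (inj₁ v) (_ , refl) = Adj-sym G xz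

  size-attach : ∀ t x → size (attach t x ●) ≡ suc (size t)
  size-attach ● _ = refl
  size-attach (s ◁ t) (inj₁ x) = cong (_+ size t) (size-attach s x)
  size-attach (s ◁ t) (inj₂ y) = trans (cong (size s +_) (size-attach t y)) (+-suc _ _)

  -- `k` bounds the number of vertices still missing. At `zero` a further extension would embed more
  -- than `n` vertices.
  span : Connected G → ∀ k {t} → Embedding t → n ≤ k + size t →
    ∃ λ t′ → Σ (Embedding t′) λ ε → ∀ y → Image ε y
  span conn k {t} ε n≤ with all? (image? ε)
  ... | yes onto = t , ε , onto
  ... | no ¬onto with ¬∀⟶∃¬ n _ (image? ε) ¬onto
  ... | y , y∉ with exit ε (root t) refl (conn _ y) y∉
  ... | x , z , xz , z∉ with k
  ... | zero = contradiction
    (≤-trans (≤-reflexive (sym (size-attach t x))) (≤-trans (size≤ (extend ε x z xz z∉)) n≤)) 1+n≰n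
  ... | suc k = span conn k (extend ε x z xz z∉)
    (≤-trans n≤ (≤-reflexive (trans (sym (+-suc k (size t))) (cong (k +_) (sym (size-attach t x))))))

  -- If `x` and `y` are not adjacent in `t`, the simple path between them has at least three
  -- vertices, and the edge of `G` closes its image to a cycle.
  reflects-edges : Acyclic G → ∀ {t} (ε : Embedding t) x y → Adj G (embed ε x) (embed ε y) → Edge ⟦ t ⟧ x y
  reflects-edges acyclic {t} ε x y e with edge? t x y
  ... | yes p = p
  ... | no ¬p with simplePath t x y
  ... | _ , [ _ ] , _ = contradiction e (¬Adj-refl G)
  ... | _ , (f ∷ [ _ ]) , _ = contradiction f ¬p
  ... | l@(_ ∷ _ ∷ _ ∷ _) , p@(_ ∷ _ ∷ _) , u = contradiction
    (map⁺ (λ {a} {b} → injective ε a b) u , Path⇒ChainTo (Path-map (embed ε) (edge ε) p) (Adj-sym G e))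
    (acyclic (map (embed ε) l))

  IsTree⇒≃ : Fin n → IsTree G → ∃ λ t → toDigraph G ≃ ⟦ t ⟧
  IsTree⇒≃ v (conn , acyclic) with span conn n single (m≤m+n n _)
    where
    single : Embedding ●
    single = record { embed = λ _ → v ; injective = λ _ _ _ → refl ; edge = λ _ _ () }
  ... | t , ε , onto = t , record
    { to = proj₁ ∘ onto ; from = embed ε
    ; from∘to = proj₂ ∘ onto
    ; to∘from = λ x → injective ε _ _ (proj₂ (onto (embed ε x)))
    ; to-edge = λ x y e → reflects-edges acyclic ε _ _
        (subst₂ (Adj G) (sym (proj₂ (onto x))) (sym (proj₂ (onto y))) e)
    ; from-edge = edge ε }

-- Realising and coding rooted trees

≃⇒size : ∀ {n} {G : Graph n} t → toDigraph G ≃ ⟦ t ⟧ → size t ≡ n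
≃⇒size t π = sym (↔⇒≡ (↔-trans (mk↔ₛ′ (to π) (from π) (to∘from π) (from∘to π)) (Vertex↔Fin t)))

realize : ∀ t → Σ (Graph (size t)) λ G → toDigraph G ≃ ⟦ t ⟧
realize t = G , record
  { to = i⁻ ; from = i⁺
  ; from∘to = Inverse.strictlyInverseˡ (Vertex↔Fin t)
  ; to∘from = Inverse.strictlyInverseʳ (Vertex↔Fin t)
  ; to-edge = λ x y → does⇒ (edge? t (i⁻ x) (i⁻ y))
  ; from-edge = λ x y e → dec-true (edge? t _ _)
      (subst₂ (Edge ⟦ t ⟧) (sym (Inverse.strictlyInverseʳ (Vertex↔Fin t) x))
                           (sym (Inverse.strictlyInverseʳ (Vertex↔Fin t) y)) e) }
  where
  i⁺ = Inverse.to (Vertex↔Fin t)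
  i⁻ = Inverse.from (Vertex↔Fin t)
  does⇒ : ∀ {P : Set} (P? : Dec P) → does P? ≡ true → P
  does⇒ (yes p) _ = p
  G : Graph (size t)
  G = record
    { adj = λ x y → does (edge? t (i⁻ x) (i⁻ y))
    ; sym = λ x y → ⇔⇒≡
        (λ e → dec-true (edge? t _ _) (edge-sym t _ _ (does⇒ (edge? t (i⁻ x) (i⁻ y)) e)))
        (λ e → dec-true (edge? t _ _) (edge-sym t _ _ (does⇒ (edge? t (i⁻ y) (i⁻ x)) e)))
    ; irrefl = λ x → dec-false (edge? t _ _) (edge-irrefl t _) }

exchangePiece : ∀ {n} {G : Graph n} a h k → size h ≡ size k → toDigraph G ≃ ⟦ glue a h ⟧ →
  Σ (Graph n) λ H → toDigraph H ≃ ⟦ glue a k ⟧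
exchangePiece {n} {G} a h k eq π =
  subst (λ m → Σ (Graph m) λ H → toDigraph H ≃ ⟦ glue a k ⟧) size≡n (realize (glue a k))
  where
  size≡n : size (glue a k) ≡ n
  size≡n = ℕ-suc-injective (begin
    suc (size (glue a k)) ≡⟨ size-glue a k ⟩
    size a + size k       ≡⟨ cong (size a +_) eq ⟨
    size a + size h       ≡⟨ size-glue a h ⟨
    suc (size (glue a h)) ≡⟨ cong suc (≃⇒size {G = G} (glue a h) π) ⟩
    suc n                 ∎)
    where open ≡-Reasoning

size≥1 : ∀ t → 1 ≤ size t
size≥1 ● = s≤s z≤n
size≥1 (s ◁ t) = ≤-trans (size≥1 s) (m≤m+n _ _)

-- A tree of size at most `k + 1` is `●` or a pair of trees of size at most `k`, hence `K * K + 1`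
-- codes. Isomorphic trees may get different codes, since any finite number suffices.
coding : ∀ k → ∃ λ K → Σ (Rooted → Fin K) λ code →
  ∀ s t → size s ≤ k → size t ≤ k → code s ≡ code t → s ≡ t
coding zero = 1 , (λ _ → zero) , λ s t s≤ _ _ → contradiction (≤-trans (size≥1 s) s≤) λ ()
coding (suc k) with coding k
... | K , code , inj = suc (K * K) , code′ , inj′
  where
  code′ : Rooted → Fin (suc (K * K))
  code′ ● = zero
  code′ (s ◁ t) = suc (combine (code s) (code t))
  left≤ : ∀ s t → size s + size t ≤ suc k → size s ≤ k
  left≤ s t ≤k = ≤-pred (≤-trans (≤-trans (≤-reflexive (+-comm 1 (size s))) (+-monoʳ-≤ (size s) (size≥1 t))) ≤k)
  right≤ : ∀ s t → size s + size t ≤ suc k → size t ≤ k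
  right≤ s t ≤k = ≤-pred (≤-trans (+-monoˡ-≤ (size t) (size≥1 s)) ≤k)
  inj′ : ∀ s t → size s ≤ suc k → size t ≤ suc k → code′ s ≡ code′ t → s ≡ t
  inj′ ● ● _ _ _ = refl
  inj′ (s ◁ s′) (t ◁ t′) s≤ t≤ eq with combine-injective (code s) (code s′) (code t) (code t′) (suc-injective eq)
  ... | eq₁ , eq₂ = cong₂ _◁_ (inj s t (left≤ s s′ s≤) (left≤ t t′ t≤) eq₁)
                              (inj s′ t′ (right≤ s s′ s≤) (right≤ t t′ t≤) eq₂)

-- The injection behind the bound

module Counting {n t s : ℕ} (n≥6 : 6 ≤ n) (T : Fin t → Graph n) (S : Fin s → Graph n)
  (repT : IsRepSystem IsTree T) (repS : IsRepSystem IsNSPTree S)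
  {K : ℕ} (code : Rooted → Fin K)
  (code-injective : ∀ h k → size h ≤ 10 → size k ≤ 10 → code h ≡ code k → h ≡ k) where

  -- The code `zero` is reserved for trees with a gadget, hence `suc K`. The number `i` of extra
  -- leaves is determined by `h`, so recording `h` is enough.
  data Encodes (G : Graph n) : Fin (suc K) → Fin s → Set where
    kept     : ∀ {j} → toDigraph G ≃ toDigraph (S j) → Encodes G zero j
    replaced : ∀ a h i {j} → size h ≤ 10 → size h ≡ 6 + i →
      toDigraph G ≃ ⟦ glue a h ⟧ → toDigraph (S j) ≃ ⟦ glue a (broom i) ⟧ →
      (∀ w → ¬ Gadget (toDigraph G) w) → Encodes G (suc (code h)) j

  represent : ∀ {A} (H : Graph n) → IsTree H → toDigraph H ≃ A → ∃ (Gadget A) →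
    ∃ λ j → toDigraph (S j) ≃ A
  represent H tree σ (_ , gadget) =
    let j , iso = proj₂ (proj₂ repS) H (tree , Gadget⇒NSP H (Gadget-≃ (≃-sym σ) gadget))
    in j , ≃-trans (≃-sym (≅⇒≃ {G = H} {S j} iso)) σ

  encode : ∀ G → IsTree G → ∃₂ (Encodes G)
  encode G tree with gadget? G
  ... | yes gadget =
    let j , iso = represent {toDigraph G} G tree ≃-refl gadget
    in zero , j , kept (≃-sym iso)
  encode G tree | no ¬gadget with IsTree⇒≃ G (fromℕ< n≥6) tree
  ... | u , π with decompose u (≤-trans n≥6 (≤-reflexive (sym (≃⇒size {G = G} u π))))
  ... | record { base = a ; piece = h ; 6≤piece = 6≤h ; piece≤10 = h≤10 ; iso = ρ } =
    let i = size h ∸ 6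
        size-h = sym (m+[n∸m]≡n 6≤h)
        H , σ = exchangePiece {G = G} a h (broom i) (trans size-h (sym (size-broom i))) (≃-trans π ρ)
        j , τ = represent H (≃⇒IsTree H {glue a (broom i)} σ) σ (root (glue a (broom i)) , broom-gadget a i)
    in suc (code h) , j , replaced a h i h≤10 size-h (≃-trans π ρ) τ (λ w g → ¬gadget (w , g))

  -- Equal codes give equal pieces and so equal brooms; both broom trees are isomorphic to the same
  -- `S j`, and the broom can be traded back for the piece.
  decode : ∀ {G H c d j} → Encodes G c j → Encodes H d j → c ≡ d → toDigraph G ≃ toDigraph H
  decode (kept π) (kept ρ) _ = ≃-trans π (≃-sym ρ)
  decode (replaced a h i h≤ size-h πG πS bare) (replaced b k i′ k≤ size-k ρH ρS bare′) eq
    with refl ← code-injective h k h≤ k≤ (suc-injective eq)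
    with refl ← +-cancelˡ-≡ 6 i i′ (trans (sym size-h) size-k) =
    ≃-trans πG (≃-trans
      (unbroom {a} {b} i h (λ w g → bare′ _ (Gadget-≃ (≃-sym ρH) g)) (≃-trans (≃-sym πS) ρS))
      (≃-sym ρH))

  count : 1 * t ≤ suc K * s
  count = subst (_≤ suc K * s) (sym (*-identityˡ t)) (injective⇒≤ {f = f} f-injective)
    where
    codes : ∀ x → ∃₂ (Encodes (T x))
    codes x = encode (T x) (proj₁ repT x)
    f : Fin t → Fin (suc K * s)
    f x = combine (proj₁ (codes x)) (proj₁ (proj₂ (codes x)))
    f-injective : ∀ {x y} → f x ≡ f y → x ≡ y
    f-injective {x} {y} eq with combine-injective (proj₁ (codes x)) _ (proj₁ (codes y)) _ eq
    ... | eq₁ , eq₂ = proj₁ (proj₂ repT) x y (≃⇒≅ {G = T x} {T y} (decode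
      (subst (Encodes (T x) _) eq₂ (proj₂ (proj₂ (codes x)))) (proj₂ (proj₂ (codes y))) eq₁))

theorem4p1 : Σ ℕ λ p → Σ ℕ λ q → Σ ℕ λ N → ∀ n → N ≤ n →
    ∀ t s (T : Fin t → Graph n) (S : Fin s → Graph n) →
    IsRepSystem IsTree T → IsRepSystem IsNSPTree S →
    suc p * t ≤ suc q * s
-- The ratio is at least 1 / (K + 1), where K is the number of codes for pieces with at most 10
-- vertices.
theorem4p1 = 0 , proj₁ (coding 10) , 6 , λ n 6≤n t s T S repT repS →
  Counting.count 6≤n T S repT repS {proj₁ (coding 10)} (proj₁ (proj₂ (coding 10))) (proj₂ (proj₂ (coding 10)))
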